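{- For $t\geq 5$, the $\mathrm{PAG}_t$ algorithm Flush-between-Blocks ($\mathrm{FbB}$) is $\left(t-\frac{1}{3t^2},\,2t,\,1-\frac{1}{3t^2}\right)$-competitive with respect to $(\mu_0,\mu_1)$.
   Context: Paging with Discard Predictions $\mathrm{PAG}_t$: a universe $U$ of $N>t$ pages and a cache holding $t$ pages, initially empty. An instance is $(x,\hat x,r)$ where $r=\langle r_1,\dots,r_n\rangle$ is a sequence of pages; when $r_i$ is requested (together with the prediction bit $\hat x_i$) and its page is not in cache (a fault), the algorithm must bring it into cache, evicting a page of its choice if the cache is full. Cost = number of faults. $\mathrm{LFD}$ is the optimal offline algorithm that fills the cache and on a fault with full cache evicts the page whose next request is furthest in the future. $x_i=0$ if $\mathrm{LFD}$ keeps the page of $r_i$ in cache until it is next requested (or, if never requested again, until the end), and $x_i=1$ otherwise; $\hat x_i$ predicts $x_i$. $\mu_0=\sum_i x_i(1-\hat x_i)$, $\mu_1=\sum_i(1-x_i)\hat x_i$. An algorithm is $(\alpha,\beta,\gamma)$-competitive w.r.t. $(\mu_0,\mu_1)$ if there is a constant $\kappa$ with $\mathrm{Alg}(I)\le\alpha\,\mathrm{LFD}(I)+\beta\,\mu_0(I)+\gamma\,\mu_1(I)+\kappa$ for all instances $I$. A page has prediction $b$ if the latest request to it came with prediction $b$. $\mathrm{FbB}$ partitions the input into consecutive blocks: a block starts at the beginning of the sequence or right after the previous block ends. When a block ends, the cache is flushed (emptied). On a fault with full cache that does not end the block, $\mathrm{FbB}$ evicts, among the pages in cache with prediction $1$ that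 have not already been evicted within the current block, the one that has been in cache longest. A block ends with a request causing a fault when the cache is full and either (Condition 1) all pages in cache have prediction $0$, or (Condition 2) some page in cache has prediction $1$ but every page in cache with prediction $1$ has already been evicted within the block; on this last request of the block an arbitrary page is evicted. -}

module Defs where

open import Data.Bool using (Bool; true; false; _∧_; _∨_; not; if_then_else_)
open import Data.Nat using (ℕ; zero; suc; _+_; _*_; _≤_; _<_; _<?_)
import Data.Bool
open import Data.Fin using (Fin)
import Data.Fin as Fin
open import Data.List using (List; []; _∷_; _++_; [_]; length; filter; map)
open import Data.List.Membership.Propositional using (_∈_)
import Data.List.Membership.DecPropositional as DP
open import Relation.Nullary using (Dec)
open import Data.Product using (_×_; _,_; proj₁; proj₂)
open import Data.Integer using (+_)
open import Data.Rational using (ℚ; 0ℚ; _/_)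
open import Relation.Nullary using (¬_; does; ¬?)
open import Relation.Binary.PropositionalEquality using (_≡_)

Page : ℕ → Set
Page N = Fin N

-- A cache is a list of (distinct) pages.
Cache : ℕ → Set
Cache N = List (Page N)

Instance : ℕ → Set
Instance N = List (Page N × Bool)

requests : ∀ {N} → Instance N → List (Page N)
requests I = map proj₁ I

predictions : ∀ {N} → Instance N → List Bool
predictions I = map proj₂ I

_∈?_ : ∀ {N} (p : Page N) (C : Cache N) → Dec (p ∈ C)
_∈?_ {N} = DP._∈?_ (Fin._≟_ {N})

_∈ᵇ_ : ∀ {N} → Page N → Cache N → Bool
p ∈ᵇ C = does (p ∈? C)

remove : ∀ {N} → Page N → Cache N → Cache N
remove q C = filter (λ y → ¬? (y Fin.≟ q)) C

-- Index (within the list of future requests) of the next request to p;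
-- if p is never requested again, the length of the list, which is
-- strictly larger than every actual index ("infinitely far").
nextIdx : ∀ {N} → Page N → List (Page N) → ℕ
nextIdx p []       = 0
nextIdx p (r ∷ rs) = if does (r Fin.≟ p) then 0 else suc (nextIdx p rs)

data LFDStep (t : ℕ) {N : ℕ} (C : Cache N) (r : Page N)
             (future : List (Page N)) : Cache N → Set where
  hit   : r ∈ C → LFDStep t C r future C
  fill  : ¬ (r ∈ C) → length C < t → LFDStep t C r future (r ∷ C)
  evict : (q : Page N) → ¬ (r ∈ C) → length C ≡ t → q ∈ C →
          (∀ q' → q' ∈ C → nextIdx q' future ≤ nextIdx q future) →
          LFDStep t C r future (r ∷ remove q C)

-- A (valid) run of LFD starting in cache C on the requests rs, given by
-- the list of caches after serving each request. Ties (among pages never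
-- requested again) may be broken arbitrarily.
data LFDFrom (t : ℕ) {N : ℕ} : Cache N → List (Page N) → List (Cache N) → Set where
  done : ∀ {C} → LFDFrom t C [] []
  step : ∀ {C r rs C' Cs} → LFDStep t C r rs C' → LFDFrom t C' rs Cs →
         LFDFrom t C (r ∷ rs) (C' ∷ Cs)

LFDRun : (t : ℕ) {N : ℕ} → Instance N → List (Cache N) → Set
LFDRun t I Cs = LFDFrom t [] (requests I) Cs

faults : ∀ {N} → Cache N → List (Page N) → List (Cache N) → ℕ
faults C (r ∷ rs) (C' ∷ Cs) = (if r ∈ᵇ C then 0 else 1) + faults C' rs Cs
faults C _ _ = 0

lfdCost : ∀ {N} → Instance N → List (Cache N) → ℕ
lfdCost I Cs = faults [] (requests I) Cs

-- kept p rs (C ∷ Cs): C is the cache after some request j, rs the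
-- requests after j, Cs the caches after them. True iff p stays in cache
-- until it is next requested (or until the end).
kept : ∀ {N} → Page N → List (Page N) → List (Cache N) → Bool
kept p rs       []       = true
kept p []       (C ∷ Cs) = p ∈ᵇ C
kept p (r ∷ rs) (C ∷ Cs) = (p ∈ᵇ C) ∧ (if does (r Fin.≟ p) then true else kept p rs Cs)

xbits : ∀ {N} → List (Page N) → List (Cache N) → List Bool
xbits (r ∷ rs) (C ∷ Cs) = not (kept r rs (C ∷ Cs)) ∷ xbits rs Cs
xbits _ _ = []

μ₀' : List Bool → List Bool → ℕ
μ₀' (true ∷ xs) (false ∷ ys) = suc (μ₀' xs ys)
μ₀' (_ ∷ xs)    (_ ∷ ys)     = μ₀' xs ys
μ₀' _ _ = 0

μ₁' : List Bool → List Bool → ℕ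
μ₁' (false ∷ xs) (true ∷ ys) = suc (μ₁' xs ys)
μ₁' (_ ∷ xs)     (_ ∷ ys)    = μ₁' xs ys
μ₁' _ _ = 0

μ₀ : ∀ {N} → Instance N → List (Cache N) → ℕ
μ₀ I Cs = μ₀' (xbits (requests I) Cs) (predictions I)

μ₁ : ∀ {N} → Instance N → List (Cache N) → ℕ
μ₁ I Cs = μ₁' (xbits (requests I) Cs) (predictions I)

-- State: cache in order of insertion (oldest first), pages evicted
-- within the current block, and the current prediction of every page.
record FbBState (N : ℕ) : Set where
  constructor ⟨_,_,_⟩
  field
    cache   : Cache N
    evicted : List (Page N)
    pred    : Page N → Bool

update : ∀ {N} → (Page N → Bool) → Page N → Bool → Page N → Bool
update f p b q = if does (q Fin.≟ p) then b else f q

fbbFrom : (t : ℕ) {N : ℕ} → FbBState N → Instance N → ℕ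
fbbFrom t st [] = 0
fbbFrom t ⟨ C , E , f ⟩ ((p , b) ∷ rs) with p ∈ᵇ C
... | true  = fbbFrom t ⟨ C , E , update f p b ⟩ rs
... | false with does (length C <? t)
...   | true  = suc (fbbFrom t ⟨ C ++ [ p ] , E , update f p b ⟩ rs)
...   | false with filter (λ q → ¬? (q ∈? E)) (filter (λ q → f q Data.Bool.≟ true) C)
-- no prediction-1 page in cache that is not yet evicted in this block
-- (Condition 1 or Condition 2): the block ends, the cache is flushed
...     | []    = suc (fbbFrom t ⟨ [] , [] , update f p b ⟩ rs)
...     | q ∷ _ = suc (fbbFrom t ⟨ remove q C ++ [ p ] , q ∷ E , update f p b ⟩ rs)

fbbCost : (t : ℕ) {N : ℕ} → Instance N → ℕ
fbbCost t I = fbbFrom t ⟨ [] , [] , (λ _ → false) ⟩ I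

ℕ→ℚ : ℕ → ℚ
ℕ→ℚ n = + n / 1

-- 1 / (3 t²)  (value at t = 0 is irrelevant; used only for t ≥ 5)
oneOver3t² : ℕ → ℚ
oneOver3t² zero    = 0ℚ
oneOver3t² (suc k) = + 1 / (3 * suc k * suc k)

{-# OPTIONS --safe #-}

-- Every block satisfies the bound separately. If LFD has L faults in a block, the block has at most
-- t + L distinct pages. When FbB faults again on a page of the block, that page was evicted with
-- prediction 1, so either LFD faults as well, or the prediction was wrong and contributes to μ₁.
-- As a page is evicted at most once per block, FbB pays at most t + L + ρ in the block, with
-- ρ ≤ min(μ₁, t + 1). For L ≥ 2 this is within the budget. If L = 1, the block contributes to μ₀:
-- LFD ends the block without some page z of FbB's full cache; prediction 1 for z would mean that
-- FbB evicted z and faulted on it again after t + 1 distinct pages had been requested, i.e. after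
-- the only LFD fault, so LFD would still hold z. The unfinished last block costs at most 2t extra.
module Submission where

open import Defs
open import Data.Nat using (ℕ; suc; _≤_; _<_; _*_; s≤s; z≤n)
import Data.Nat as ℕ
import Data.Nat.Properties as ℕ
open import Data.Nat.Tactic.RingSolver using (solve-∀)
open import Data.Bool using (Bool; T; true; false; _∧_; not; if_then_else_)
import Data.Bool.Properties as Bool
import Data.Fin as Fin
open import Data.Integer using (+_)
import Data.Integer as ℤ
import Data.Integer.Properties as ℤ
open import Data.List using (List; []; _∷_; _++_; [_]; length; filter)
open import Data.List.Properties using (filter-notAll; length-++)
open import Data.List.Membership.Propositional using (_∈_; _∉_; lose; find)
open import Data.List.Membership.Propositional.Properties using (∈-filter⁺; ∈-filter⁻; ∈-++⁺ˡ; ∈-++⁺ʳ; ∈-++⁻)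
open import Data.List.Relation.Binary.Subset.Propositional using (_⊆_)
open import Data.List.Relation.Unary.Any using (here; there)
open import Data.List.Relation.Unary.All using (all?; lookup)
open import Data.List.Relation.Unary.All.Properties using (¬All⇒Any¬; ¬Any⇒All¬)
open import Data.List.Relation.Unary.Unique.Propositional using (Unique; []; _∷_)
open import Data.List.Relation.Unary.Unique.Propositional.Properties using (filter⁺; ++⁺; Unique[x∷xs]⇒x∉xs)
open import Data.Product using (∃-syntax; _×_; _,_; proj₁; proj₂)
open import Data.Unit using (tt)
open import Data.Sum using (_⊎_; inj₁; inj₂; [_,_]′)
open import Data.Rational.Unnormalised using (mkℚᵘ; *≡*; *≤*)
import Data.Rational.Unnormalised as ℚᵘ
import Data.Rational.Unnormalised.Properties as ℚᵘ
open import Data.Rational.Solver using (module +-*-Solver)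
import Data.Rational.Properties as ℚ
open import Function using (_∘_)
open import Relation.Nullary using (yes; no; ¬?; contradiction)
open import Relation.Nullary.Decidable using (dec-true; dec-false)
open import Relation.Binary.PropositionalEquality using (_≡_; _≢_; refl; sym; trans; cong; cong₂; subst; subst₂)

-- Duplicate-free lists of pages as finite sets.

module _ {N : ℕ} where

  private
    variable
      q r : Page N
      C S F : List (Page N)

  ∈-remove⁺ : q ∈ C → q ≢ r → q ∈ remove r C
  ∈-remove⁺ {r = r} = ∈-filter⁺ (λ y → ¬? (y Fin.≟ r))

  ∈-remove⁻ : q ∈ remove r C → q ∈ C × q ≢ r
  ∈-remove⁻ {r = r} = ∈-filter⁻ (λ y → ¬? (y Fin.≟ r))

  length-remove : r ∈ C → length (remove r C) < length C
  length-remove {r} {C} r∈C =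
    filter-notAll (λ y → ¬? (y Fin.≟ r)) C (lose r∈C (λ r≢r → r≢r refl))

  -- Pigeonhole by induction on `S`: deleting its head from `C` shortens `C`, and by uniqueness the
  -- tail of `S` survives the deletion.
  Unique-⊆⇒length≤ : Unique S → S ⊆ C → length S ≤ length C
  Unique-⊆⇒length≤ [] S⊆C = z≤n
  Unique-⊆⇒length≤ (x∉ ∷ u) S⊆C =
    ℕ.≤-trans
      (s≤s (Unique-⊆⇒length≤ u λ y∈ →
        ∈-remove⁺ (S⊆C (there y∈)) λ { refl → Unique[x∷xs]⇒x∉xs (x∉ ∷ u) y∈ }))
      (length-remove (S⊆C (here refl)))

  Unique-∷ : r ∉ S → Unique S → Unique (r ∷ S)
  Unique-∷ r∉S u = ¬Any⇒All¬ _ r∉S ∷ u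

  Unique-++[] : r ∉ F → Unique F → Unique (F ++ [ r ])
  Unique-++[] r∉F u = ++⁺ u (Unique-∷ (λ ()) []) λ { (r∈F , here refl) → r∉F r∈F }

  length-++[] : (F : List (Page N)) → length (F ++ [ r ]) ≡ suc (length F)
  length-++[] F = trans (length-++ F) (ℕ.+-comm (length F) 1)

  escapes : Unique S → length C < length S → ∃[ z ] z ∈ S × z ∉ C
  escapes {S} {C} u C<S with all? (_∈? C) S
  ... | yes S⊆C = contradiction (Unique-⊆⇒length≤ u (lookup S⊆C)) (ℕ.<⇒≱ C<S)
  ... | no  S⊈C = find (¬All⇒Any¬ (_∈? C) S S⊈C)

  insert : Page N → List (Page N) → List (Page N)
  insert r S with r ∈? S
  ... | yes _ = S
  ... | no  _ = r ∷ S

  ⊆-insert : q ∈ S → q ∈ insert r S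
  ⊆-insert {S = S} {r} q∈S with r ∈? S
  ... | yes _ = q∈S
  ... | no  _ = there q∈S

  ∈-insert : ∀ r S → r ∈ insert r S
  ∈-insert r S with r ∈? S
  ... | yes r∈S = r∈S
  ... | no  _   = here refl

  ∈-insert⁻ : q ∈ insert r S → q ≡ r ⊎ q ∈ S
  ∈-insert⁻ {r = r} {S} q∈ with r ∈? S | q∈
  ... | yes _ | q∈S       = inj₂ q∈S
  ... | no  _ | here q≡r  = inj₁ q≡r
  ... | no  _ | there q∈S = inj₂ q∈S

  Unique-insert : Unique S → Unique (insert r S)
  Unique-insert {S} {r} u with r ∈? S
  ... | yes _   = u
  ... | no  r∉S = Unique-∷ r∉S u

  update-other : ∀ {b} (f : Page N → Bool) → q ≢ r → update f r b q ≡ f q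
  update-other {q} {r} f q≢r rewrite dec-false (q Fin.≟ r) q≢r = refl

  -- Single steps of LFD and FbB.

  module _ {t : ℕ} {rs : List (Page N)} {C′ : Cache N} where

    LFDStep-⊆ : LFDStep t C r rs C′ → C′ ⊆ r ∷ C
    LFDStep-⊆ (hit _)             q∈         = there q∈
    LFDStep-⊆ (fill _ _)          q∈         = q∈
    LFDStep-⊆ (evict _ _ _ _ _)   (here eq)  = here eq
    LFDStep-⊆ (evict _ _ _ _ _)   (there q∈) = there (proj₁ (∈-remove⁻ q∈))

    LFDStep-∈ : LFDStep t C r rs C′ → r ∈ C′
    LFDStep-∈ (hit r∈C)         = r∈C
    LFDStep-∈ (fill _ _)        = here refl
    LFDStep-∈ (evict _ _ _ _ _) = here refl

    LFDStep-length : LFDStep t C r rs C′ → length C ≤ t → length C′ ≤ t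
    LFDStep-length (hit _)                 C≤t = C≤t
    LFDStep-length (fill _ C<t)            _   = C<t
    LFDStep-length (evict q _ refl q∈C _)  _   = length-remove q∈C

    LFDStep-hit : LFDStep t C r rs C′ → r ∈ C → C′ ≡ C
    LFDStep-hit (hit _)             _   = refl
    LFDStep-hit (fill r∉C _)        r∈C = contradiction r∈C r∉C
    LFDStep-hit (evict _ r∉C _ _ _) r∈C = contradiction r∈C r∉C

  fault : Page N → Cache N → ℕ
  fault r C = if r ∈ᵇ C then 0 else 1

  fault-∉ : r ∉ C → fault r C ≡ 1
  fault-∉ {r} {C} r∉C rewrite dec-false (r ∈? C) r∉C = refl

  kept-∉ : ∀ rs {Cs} → q ∉ C → kept q rs (C ∷ Cs) ≡ false
  kept-∉ {q} {C} []      q∉C rewrite dec-false (q ∈? C) q∉C = refl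
  kept-∉ {q} {C} (_ ∷ _) q∉C rewrite dec-false (q ∈? C) q∉C = refl

  kept-∈ : ∀ {rs Cs} → r ∈ C → kept r (r ∷ rs) (C ∷ Cs) ≡ true
  kept-∈ {r} {C} r∈C
    rewrite dec-true (r ∈? C) r∈C | dec-true (r Fin.≟ r) refl = refl

  -- A request to `r` brings in no page but `r`. So a page `q` missing from `C` is still missing
  -- from `C′`, and both sides are `false`.
  kept-step : ∀ {t rs C′ Cs} → LFDStep t C r rs C′ → q ≢ r →
    kept q (r ∷ rs) (C ∷ C′ ∷ Cs) ≡ kept q rs (C′ ∷ Cs)
  kept-step {C} {r} {q} {rs = rs} s q≢r with q ∈? C
  ... | yes _ rewrite dec-false (r Fin.≟ q) (q≢r ∘ sym) = refl
  ... | no q∉C = sym (kept-∉ rs λ q∈C′ → case (LFDStep-⊆ s q∈C′))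
    where
    case : q ∈ r ∷ C → _
    case (here q≡r)  = q≢r q≡r
    case (there q∈C) = q∉C q∈C

  -- A relational view of one step of `fbbFrom`, indexed by its cost and next state. The premise of
  -- `flush` covers both block-ending conditions; under Condition 1 it holds vacuously.
  data FbBStep (t : ℕ) (F E : List (Page N)) (f : Page N → Bool) (r : Page N) (b : Bool) :
       ℕ → FbBState N → Set where
    hit   : r ∈ F → FbBStep t F E f r b 0 ⟨ F , E , update f r b ⟩
    fill  : r ∉ F → length F < t → FbBStep t F E f r b 1 ⟨ F ++ [ r ] , E , update f r b ⟩
    evict : ∀ q → r ∉ F → t ≤ length F → q ∈ F → q ∉ E → f q ≡ true →
            FbBStep t F E f r b 1 ⟨ remove q F ++ [ r ] , q ∷ E , update f r b ⟩
    flush : r ∉ F → t ≤ length F → (∀ {z} → z ∈ F → f z ≡ true → z ∈ E) →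
            FbBStep t F E f r b 1 ⟨ [] , [] , update f r b ⟩

  fbbStep : ∀ t F E f r b I → ∃[ k ] ∃[ st ] FbBStep t F E f r b k st ×
    fbbFrom t ⟨ F , E , f ⟩ ((r , b) ∷ I) ≡ k ℕ.+ fbbFrom t st I
  fbbStep t F E f r b I with r ∈? F
  ... | yes r∈F = _ , _ , hit r∈F , refl
  ... | no  r∉F with length F ℕ.<ᵇ t in F<ᵇt
  ...   | true  = _ , _ , fill r∉F (ℕ.<ᵇ⇒< _ _ (subst T (sym F<ᵇt) tt)) , refl
  ...   | false with filter (λ q → ¬? (q ∈? E)) (filter (λ q → f q Bool.≟ true) F) in eq
  ...     | [] = _ , _ , flush r∉F t≤F exhausted , refl
    where
    t≤F : t ≤ length F
    t≤F = ℕ.≮⇒≥ (subst T F<ᵇt ∘ ℕ.<⇒<ᵇ)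
    exhausted : ∀ {z} → z ∈ F → f z ≡ true → z ∈ E
    exhausted {z} z∈F fz with z ∈? E
    ... | yes z∈E = z∈E
    ... | no  z∉E = contradiction
      (subst (z ∈_) eq (∈-filter⁺ (λ q → ¬? (q ∈? E)) (∈-filter⁺ (λ q → f q Bool.≟ true) z∈F fz) z∉E))
      λ ()
  ...     | q ∷ _
    with q∈ , q∉E ← ∈-filter⁻ (λ q → ¬? (q ∈? E)) (subst (q ∈_) (sym eq) (here refl))
    with q∈F , fq ← ∈-filter⁻ (λ q → f q Bool.≟ true) q∈
    = _ , _ , evict q r∉F (ℕ.≮⇒≥ (subst T F<ᵇt ∘ ℕ.<⇒<ᵇ)) q∈F q∉E fq , refl

-- Prediction errors of a single request.

μ₀-bit μ₁-bit : Bool → Bool → ℕ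
μ₀-bit x y = if x ∧ not y then 1 else 0
μ₁-bit x y = if not x ∧ y then 1 else 0

μ₀′-∷ : ∀ x y xs ys → μ₀' (x ∷ xs) (y ∷ ys) ≡ μ₀-bit x y ℕ.+ μ₀' xs ys
μ₀′-∷ false false _ _ = refl
μ₀′-∷ false true  _ _ = refl
μ₀′-∷ true  false _ _ = refl
μ₀′-∷ true  true  _ _ = refl

μ₁′-∷ : ∀ x y xs ys → μ₁' (x ∷ xs) (y ∷ ys) ≡ μ₁-bit x y ℕ.+ μ₁' xs ys
μ₁′-∷ false false _ _ = refl
μ₁′-∷ false true  _ _ = refl
μ₁′-∷ true  false _ _ = refl
μ₁′-∷ true  true  _ _ = refl

-- The competitive inequality over the natural numbers.

module Blocks (t K : ℕ) (5≤t : 5 ≤ t) (t≤K : t ≤ K) (N : ℕ) where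

  open import Data.Nat using (_+_)

  -- The competitive inequality, multiplied by K = 3t² and with the negative terms moved to the left.
  Bound : (c L m₀ m₁ κ : ℕ) → Set
  Bound c L m₀ m₁ κ = K * c + L + m₁ ≤ K * t * L + K * (2 * t) * m₀ + K * m₁ + K * κ

  Bound-+ : ∀ {c c′ L L′ m₀ m₀′ m₁ m₁′ κ κ′} → Bound c L m₀ m₁ κ → Bound c′ L′ m₀′ m₁′ κ′ →
    Bound (c + c′) (L + L′) (m₀ + m₀′) (m₁ + m₁′) (κ + κ′)
  Bound-+ {c} {c′} {L} {L′} {m₀} {m₀′} {m₁} {m₁′} {κ} {κ′} p q =
    subst₂ _≤_ (lhs K c c′ L L′ m₁ m₁′) (rhs K t L L′ m₀ m₀′ m₁ m₁′ κ κ′) (ℕ.+-mono-≤ p q)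
    where
    lhs : ∀ K c c′ L L′ m₁ m₁′ →
      (K * c + L + m₁) + (K * c′ + L′ + m₁′) ≡ K * (c + c′) + (L + L′) + (m₁ + m₁′)
    lhs = solve-∀
    rhs : ∀ K t L L′ m₀ m₀′ m₁ m₁′ κ κ′ →
      (K * t * L + K * (2 * t) * m₀ + K * m₁ + K * κ) + (K * t * L′ + K * (2 * t) * m₀′ + K * m₁′ + K * κ′)
        ≡ K * t * (L + L′) + K * (2 * t) * (m₀ + m₀′) + K * (m₁ + m₁′) + K * (κ + κ′)
    rhs = solve-∀

  Bound-regroup : ∀ c k a L l b m d e n h g {κ} →
    Bound ((c + k) + a) ((L + l) + b) ((m + d) + e) ((n + h) + g) κ →
    Bound (c + (k + a)) (L + (l + b)) (m + (d + e)) (n + (h + g)) κ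
  Bound-regroup c k a L l b m d e n h g
    rewrite ℕ.+-assoc c k a | ℕ.+-assoc L l b | ℕ.+-assoc m d e | ℕ.+-assoc n h g = λ p → p

  -- Write `m₁` as `ρ + s`. The `K * ρ` in the cost is then matched by the `K * ρ` in the budget,
  -- and only the bare `ρ` on the left needs the bound `1 + t`.
  Bound-from : ∀ {c L m₀ m₁ κ ρ} → c ≤ t + L + ρ → ρ ≤ 1 + t → ρ ≤ m₁ →
    (∀ s → K * (t + L + ρ) + L + ((1 + t) + s)
             ≤ K * t * L + K * (2 * t) * m₀ + K * (ρ + s) + K * κ) →
    Bound c L m₀ m₁ κ
  Bound-from {L = L} c≤ ρ≤t ρ≤m₁ main with s , refl ← ℕ.m≤n⇒∃[o]m+o≡n ρ≤m₁ =
    ℕ.≤-trans (ℕ.+-mono-≤ (ℕ.+-monoˡ-≤ L (ℕ.*-monoʳ-≤ K c≤)) (ℕ.+-monoˡ-≤ s ρ≤t)) (main s)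

  -- In the identities below t = 5 + u, K = t + k, and the second summand is the slack.
  Bound-partial : ∀ {c L m₀ m₁ ρ} → c ≤ t + L + ρ → ρ ≤ 1 + t → ρ ≤ m₁ → Bound c L m₀ m₁ (2 * t)
  Bound-partial {c} {L} {m₀} {m₁} {ρ} c≤ ρ≤t ρ≤m₁
    with u , refl ← ℕ.m≤n⇒∃[o]m+o≡n 5≤t with k , refl ← ℕ.m≤n⇒∃[o]m+o≡n t≤K =
    Bound-from {m₀ = m₀} {κ = 2 * (5 + u)} c≤ ρ≤t ρ≤m₁ λ s → ℕ.m+n≤o⇒m≤o _ (ℕ.≤-reflexive (identity u k L ρ s m₀))
    where
    identity : ∀ u k L ρ s m₀ → let t = 5 + u ; K = 5 + u + k in
      (K * (t + L + ρ) + L + ((1 + t) + s))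
        + (19 + 9 * u + u * u + 5 * k + u * k + L * (19 + 9 * u + u * u + 4 * k + u * k)
           + (4 + u + k) * s + K * (2 * t) * m₀)
        ≡ K * t * L + K * (2 * t) * m₀ + K * (ρ + s) + K * (2 * t)
    identity = solve-∀

  -- After cancelling `K * ρ`, a surplus of `L + 1 + t` is needed. For `2 ≤ L` it comes from
  -- `K * (t * L - (t + L))`, which is `K * (t - 2)` at `L = 2`; at `L = 1` that term is `-K`, and
  -- one unit of μ₀ adds `K * (2 * t)`.
  Bound-block : ∀ {c L m₀ m₁ ρ} → c ≤ t + L + ρ → ρ ≤ 1 + t → ρ ≤ m₁ →
    2 ≤ L ⊎ (1 ≤ L × 1 ≤ m₀) → Bound c L m₀ m₁ 0
  Bound-block {c} {L} {m₀} {m₁} {ρ} c≤ ρ≤t ρ≤m₁ (inj₁ 2≤L)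
    with u , refl ← ℕ.m≤n⇒∃[o]m+o≡n 5≤t with k , refl ← ℕ.m≤n⇒∃[o]m+o≡n t≤K
    with l , refl ← ℕ.m≤n⇒∃[o]m+o≡n 2≤L =
    Bound-from {m₀ = m₀} {κ = 0} c≤ ρ≤t ρ≤m₁ λ s → ℕ.m+n≤o⇒m≤o _ (ℕ.≤-reflexive (identity u k l ρ s m₀))
    where
    identity : ∀ u k l ρ s m₀ → let t = 5 + u ; K = 5 + u + k ; L = 2 + l in
      (K * (t + L + ρ) + L + ((1 + t) + s))
        + (7 + 7 * u + u * u + 3 * k + u * k + l * (19 + 9 * u + u * u + 4 * k + u * k)
           + (4 + u + k) * s + K * (2 * t) * m₀)
        ≡ K * t * L + K * (2 * t) * m₀ + K * (ρ + s) + K * 0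
    identity = solve-∀
  Bound-block {c} {L} {m₀} {m₁} {ρ} c≤ ρ≤t ρ≤m₁ (inj₂ (1≤L , 1≤m₀))
    with u , refl ← ℕ.m≤n⇒∃[o]m+o≡n 5≤t with k , refl ← ℕ.m≤n⇒∃[o]m+o≡n t≤K
    with l , refl ← ℕ.m≤n⇒∃[o]m+o≡n 1≤L with m , refl ← ℕ.m≤n⇒∃[o]m+o≡n 1≤m₀ =
    Bound-from {m₀ = 1 + m} {κ = 0} c≤ ρ≤t ρ≤m₁ λ s → ℕ.m+n≤o⇒m≤o _ (ℕ.≤-reflexive (identity u k l ρ s m))
    where
    identity : ∀ u k l ρ s m → let t = 5 + u ; K = 5 + u + k ; L = 1 + l in
      (K * (t + L + ρ) + L + ((1 + t) + s))
        + (38 + 18 * u + 2 * u * u + 9 * k + 2 * u * k + l * (19 + 9 * u + u * u + 4 * k + u * k)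
           + (4 + u + k) * s + K * (2 * t) * m)
        ≡ K * t * L + K * (2 * t) * (1 + m) + K * (ρ + s) + K * 0
    identity = solve-∀

  -- Invariants of a block.

  private
    variable
      C C′ F E S W R M rs : List (Page N)
      X X′ f : Page N → Bool
      q r : Page N
      b : Bool
      c L m₀ : ℕ

  -- Bookkeeping within a block that does not depend on FbB. S: pages requested in the block;
  -- W ⊇ S ∪ C grows only on LFD faults to pages outside S; M: pages of the μ₁-requests of the
  -- block; L, m₀: LFD faults and μ₀ of the block; X q: LFD keeps q until its next request.
  record Offline (C : Cache N) (X f : Page N → Bool) (S W M : List (Page N)) (L m₀ : ℕ) : Set where
    field
      cache-size : length C ≤ t
      S-unique   : Unique S
      S⊆W        : S ⊆ W
      C⊆W        : C ⊆ W
      W-size     : length W ≤ t + L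
      over       : ∀ {q} → q ∈ S → f q ≡ true → X q ≡ true → q ∈ M
      under      : ∀ {q} → q ∈ S → f q ≡ false → X q ≡ false → 1 ≤ m₀

    S-size : length S ≤ t + L
    S-size = ℕ.≤-trans (Unique-⊆⇒length≤ S-unique S⊆W) W-size

  -- Repetitions are retained, so that the length of `M` is exactly the μ₁ of the block, while a
  -- duplicate-free sublist still bounds it from below.
  overPages : Page N → Bool → Bool → List (Page N) → List (Page N)
  overPages r x b M = if not x ∧ b then r ∷ M else M

  overPages-⊆ : ∀ x b → M ⊆ overPages r x b M
  overPages-⊆ true  _     q∈ = q∈
  overPages-⊆ false true  q∈ = there q∈
  overPages-⊆ false false q∈ = q∈

  length-overPages : ∀ x b → length (overPages r x b M) ≡ length M + μ₁-bit x b
  length-overPages {M = M} true  _     = sym (ℕ.+-identityʳ (length M))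
  length-overPages {M = M} false true  = ℕ.+-comm 1 (length M)
  length-overPages {M = M} false false = sym (ℕ.+-identityʳ (length M))

  module _ (off : Offline C X f S W M L m₀) where
    open Offline off

    Offline-step : LFDStep t C r rs C′ → (∀ {q} → q ≢ r → X q ≡ X′ q) →
      Offline C′ X′ (update f r b) (insert r S) (insert r W)
        (overPages r (not (X′ r)) b M) (L + fault r C) (m₀ + μ₀-bit (not (X′ r)) b)
    Offline-step {r = r} {C′ = C′} {X′ = X′} {b = b} s X~X′ = record
      { cache-size = LFDStep-length s cache-size
      ; S-unique   = Unique-insert S-unique
      ; S⊆W        = λ q∈ → [ (λ { refl → ∈-insert r W }) , (λ q∈S → ⊆-insert (S⊆W q∈S)) ]′ (∈-insert⁻ q∈)
      ; C⊆W        = C′⊆W′ ∘ LFDStep-⊆ s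
      ; W-size     = W′-size
      ; over       = over′
      ; under      = under′
      }
      where
      C′⊆W′ : ∀ {q} → q ∈ r ∷ C → q ∈ insert r W
      C′⊆W′ (here refl) = ∈-insert r W
      C′⊆W′ (there q∈C) = ⊆-insert (C⊆W q∈C)

      W′-size : length (insert r W) ≤ t + (L + fault r C)
      W′-size with r ∈? W
      ... | yes _ = ℕ.≤-trans W-size (ℕ.+-monoʳ-≤ t (ℕ.m≤m+n L _))
      -- A page outside `W` is outside `C`, so each growth of `W` is paid for by an LFD fault.
      ... | no r∉W rewrite fault-∉ (r∉W ∘ C⊆W) | ℕ.+-comm L 1 | ℕ.+-suc t L = s≤s W-size

      over′ : ∀ {q} → q ∈ insert r S → update f r b q ≡ true → X′ q ≡ true →
        q ∈ overPages r (not (X′ r)) b M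
      over′ {q} q∈ fq Xq with q Fin.≟ r
      -- For `r` itself, prediction 1 while LFD keeps it is precisely a μ₁-error, so `r` has just
      -- joined the list.
      ... | yes refl rewrite Xq | fq = here refl
      ... | no q≢r = overPages-⊆ (not (X′ r)) b
        (over ([ (λ q≡r → contradiction q≡r q≢r) , (λ q∈S → q∈S) ]′ (∈-insert⁻ q∈)) fq (trans (X~X′ q≢r) Xq))

      under′ : ∀ {q} → q ∈ insert r S → update f r b q ≡ false → X′ q ≡ false →
        1 ≤ m₀ + μ₀-bit (not (X′ r)) b
      under′ {q} q∈ fq Xq with q Fin.≟ r
      ... | yes refl rewrite Xq | fq = ℕ.m≤n+m 1 m₀
      ... | no q≢r = ℕ.≤-trans
        (under ([ (λ q≡r → contradiction q≡r q≢r) , (λ q∈S → q∈S) ]′ (∈-insert⁻ q∈)) fq (trans (X~X′ q≢r) Xq))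
        (ℕ.m≤m+n m₀ _)

    -- The potential `|S| + L - |W|`, written without subtraction, never drops: when `W` grows, `S`
    -- grows too and LFD faults. The faults of FbB are charged to its increases.
    growth : ∀ r → length S + L + length (insert r W) ≤ length (insert r S) + (L + fault r C) + length W
    growth r with r ∈? W | r ∈? S
    ... | yes _  | yes _ = ℕ.+-monoˡ-≤ (length W) (ℕ.+-monoʳ-≤ (length S) (ℕ.m≤m+n L _))
    ... | yes _  | no _  = ℕ.+-monoˡ-≤ (length W) (ℕ.+-mono-≤ (ℕ.n≤1+n _) (ℕ.m≤m+n L _))
    ... | no r∉W | yes r∈S = contradiction (S⊆W r∈S) r∉W
    ... | no r∉W | no _ rewrite fault-∉ (r∉W ∘ C⊆W) = ℕ.≤-trans (ℕ.n≤1+n _) (ℕ.≤-reflexive (eq (length S) L (length W)))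
      where
      eq : ∀ s l w → suc (s + l + suc w) ≡ suc s + (l + 1) + w
      eq = solve-∀

    -- The potential rises when the page is new to the block or LFD faults; if both happen outside
    -- `W`, the growth of `W` absorbs only one of the two units.
    growth-strict : ∀ r → r ∉ S ⊎ r ∉ C →
      1 + (length S + L + length (insert r W)) ≤ length (insert r S) + (L + fault r C) + length W
    growth-strict r new with r ∈? W | r ∈? S
    growth-strict r (inj₁ r∉S) | yes _ | yes r∈S = contradiction r∈S r∉S
    growth-strict r (inj₂ r∉C) | yes _ | yes _ rewrite fault-∉ r∉C =
      ℕ.≤-reflexive (eq (length S) L (length W))
      where
      eq : ∀ s l w → 1 + (s + l + w) ≡ s + (l + 1) + w
      eq = solve-∀
    growth-strict r _ | yes _ | no _ =
      s≤s (ℕ.+-monoˡ-≤ (length W) (ℕ.+-monoʳ-≤ (length S) (ℕ.m≤m+n L _)))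
    growth-strict r _ | no r∉W | yes r∈S = contradiction (S⊆W r∈S) r∉W
    growth-strict r _ | no r∉W | no _ rewrite fault-∉ (r∉W ∘ C⊆W) =
      ℕ.≤-reflexive (eq (length S) L (length W))
      where
      eq : ∀ s l w → suc (s + l + suc w) ≡ suc s + (l + 1) + w
      eq = solve-∀

  -- R: pages on which FbB faulted again within the block although LFD had kept them;
  -- c: cost of FbB in the block.
  record Online (F E : List (Page N)) (f : Page N → Bool) (C : Cache N)
                (S W R M : List (Page N)) (L c : ℕ) : Set where
    field
      F-unique : Unique F
      F-size   : length F ≤ t
      F⊆S      : F ⊆ S
      S∖F⊆E    : ∀ {q} → q ∈ S → q ∉ F → q ∈ E
      absent   : ∀ {q} → q ∈ E → q ∉ F → f q ≡ true
      -- Evictions begin only after t + 1 distinct pages, hence after the first LFD fault; so LFD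
      -- can drop a page to which FbB has faulted again only at the price of a second fault.
      returned : ∀ {q} → q ∈ E → q ∈ F → q ∈ C ⊎ 2 ≤ L
      E⇒S-size : ∀ {q} → q ∈ E → t < length S
      R-unique : Unique R
      R⊆F      : R ⊆ F
      R⊆E      : R ⊆ E
      R⊆M      : R ⊆ M
      cost     : c + length W ≤ t + L + length R + length S

  Offline-start : length C ≤ t → Offline C X f [] C [] 0 0
  Offline-start {C} C≤t = record
    { cache-size = C≤t ; S-unique = [] ; S⊆W = λ () ; C⊆W = λ q∈ → q∈
    ; W-size = ℕ.≤-trans C≤t (ℕ.m≤m+n t 0) ; over = λ () ; under = λ () }

  -- A block starts with `W` equal to LFD's cache, hence with potential at least `-t`; the summand
  -- `t` in `cost` compensates for this.
  Online-start : length C ≤ t → Online [] [] f C [] C [] [] 0 0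
  Online-start C≤t = record
    { F-unique = [] ; F-size = z≤n ; F⊆S = λ () ; S∖F⊆E = λ () ; absent = λ () ; returned = λ ()
    ; E⇒S-size = λ () ; R-unique = [] ; R⊆F = λ () ; R⊆E = λ () ; R⊆M = λ ()
    ; cost = ℕ.≤-trans C≤t (ℕ.≤-reflexive (eq t)) }
    where
    eq : ∀ t → t ≡ t + 0 + 0 + 0
    eq = solve-∀

  -- A step that costs FbB `k` preserves the cost bound if the potential rises by at least `k`.
  cost-step : ∀ k {c w t L ρ s s′ L′ w′} → c + w ≤ t + L + ρ + s →
    k + (s + L + w′) ≤ s′ + L′ + w → (c + k) + w′ ≤ t + L′ + ρ + s′
  cost-step k {c} {w} {t} {L} {ρ} {s} {s′} {L′} {w′} p q =
    ℕ.+-cancelˡ-≤ (w + s + L) _ _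
      (subst₂ _≤_ (lhs k c w L s w′) (rhs t L ρ s s′ L′ w) (ℕ.+-mono-≤ p q))
    where
    lhs : ∀ k c w L s w′ → (c + w) + (k + (s + L + w′)) ≡ w + s + L + (c + k + w′)
    lhs = solve-∀
    rhs : ∀ t L ρ s s′ L′ w → (t + L + ρ + s) + (s′ + L′ + w) ≡ w + s + L + (t + L′ + ρ + s′)
    rhs = solve-∀

  -- Preservation of the FbB invariant, and the end of a block.

  module _ (off : Offline C X f S W M L m₀) (on : Online F E f C S W R M L c) where
    open Offline off
    open Online on

    returned-step : LFDStep t C r rs C′ → q ∈ E → q ∈ F → q ∈ C′ ⊎ 2 ≤ L + fault r C
    returned-step {r = r} s q∈E q∈F with returned q∈E q∈F
    ... | inj₂ 2≤L = inj₂ (ℕ.≤-trans 2≤L (ℕ.m≤m+n L _))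
    ... | inj₁ q∈C with r ∈? C
    ...   | yes r∈C rewrite LFDStep-hit s r∈C = inj₁ q∈C
    -- From `t < length S` and `length S ≤ t + L` LFD has already faulted in the block, so this
    -- fault is at least the second.
    ...   | no  r∉C = inj₂ (ℕ.+-monoˡ-≤ 1 (ℕ.+-cancelˡ-≤ t 1 L
              (ℕ.≤-trans (ℕ.≤-reflexive (ℕ.+-comm t 1)) (ℕ.≤-trans (E⇒S-size q∈E) S-size))))

    S-size-mono : length S ≤ length (insert r S)
    S-size-mono = Unique-⊆⇒length≤ S-unique ⊆-insert

    -- The outcome of charging an FbB fault on `r`, either to the potential or to a new member of
    -- `R`. Membership is in the old `M`: the error was made at an earlier request to `r`.
    record Refault (r : Page N) : Set where
      field
        R′        : List (Page N)
        R′-unique : Unique R′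
        R′⊆       : ∀ {q} → q ∈ R′ → q ≡ r ⊎ q ∈ R
        R′⊆E      : R′ ⊆ E
        R′⊆M      : R′ ⊆ M
        cost′     : (c + 1) + length (insert r W)
                      ≤ t + (L + fault r C) + length R′ + length (insert r S)

    -- If `r` is new to the block or LFD faults, the potential pays. Otherwise `r` was evicted in
    -- this block with prediction 1 although LFD kept it, so `over` places it in `M` and it can join
    -- `R`.
    refault : (r ∈ C → X r ≡ true) → r ∉ F → Refault r
    refault {r} kept-r r∉F with r ∈? S | r ∈? C
    ... | no r∉S | _ = record
      { R′ = R ; R′-unique = R-unique ; R′⊆ = inj₂ ; R′⊆E = R⊆E ; R′⊆M = R⊆M
      ; cost′ = cost-step 1 {c} {t = t} {ρ = length R} cost (growth-strict off r (inj₁ r∉S)) }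
    ... | yes _ | no r∉C = record
      { R′ = R ; R′-unique = R-unique ; R′⊆ = inj₂ ; R′⊆E = R⊆E ; R′⊆M = R⊆M
      ; cost′ = cost-step 1 {c} {t = t} {ρ = length R} cost (growth-strict off r (inj₂ r∉C)) }
    ... | yes r∈S | yes r∈C = record
      { R′ = r ∷ R ; R′-unique = Unique-∷ (r∉F ∘ R⊆F) R-unique
      ; R′⊆  = λ { (here refl) → inj₁ refl ; (there q∈) → inj₂ q∈ }
      ; R′⊆E = λ { (here refl) → r∈E ; (there q∈) → R⊆E q∈ }
      ; R′⊆M = λ { (here refl) → over r∈S (absent r∈E r∉F) (kept-r r∈C) ; (there q∈) → R⊆M q∈ }
      ; cost′ = subst₂ _≤_ (lhs c _) (rhs (t + (L + fault r C)) (length R) _)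
          (s≤s (cost-step 0 {c} {t = t} {ρ = length R} cost (growth off r))) }
      where
      r∈E : r ∈ E
      r∈E = S∖F⊆E r∈S r∉F
      lhs : ∀ c w → suc (c + 0 + w) ≡ c + 1 + w
      lhs = solve-∀
      rhs : ∀ a ρ s → suc (a + ρ + s) ≡ a + suc ρ + s
      rhs = solve-∀

    module _ (s : LFDStep t C r rs C′) (X~X′ : ∀ {q} → q ≢ r → X q ≡ X′ q) where

      private
        M′ : Bool → List (Page N)
        M′ b = overPages r (not (X′ r)) b M

        ∈-S′ : q ∈ insert r S → q ≢ r → q ∈ S
        ∈-S′ q∈ q≢r = [ (λ q≡r → contradiction q≡r q≢r) , (λ q∈S → q∈S) ]′ (∈-insert⁻ q∈)

      Online-hit : r ∈ F → Online F E (update f r b) C′ (insert r S) (insert r W) R (M′ b) (L + fault r C) (c + 0)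
      Online-hit {b = b} r∈F = record
        { F-unique = F-unique
        ; F-size   = F-size
        ; F⊆S      = ⊆-insert ∘ F⊆S
        ; S∖F⊆E    = λ q∈ q∉F → S∖F⊆E (∈-S′ q∈ λ { refl → q∉F r∈F }) q∉F
        ; absent   = λ q∈E q∉F → trans (update-other f λ { refl → q∉F r∈F }) (absent q∈E q∉F)
        ; returned = returned-step s
        ; E⇒S-size = λ q∈E → ℕ.≤-trans (E⇒S-size q∈E) S-size-mono
        ; R-unique = R-unique
        ; R⊆F      = R⊆F
        ; R⊆E      = R⊆E
        ; R⊆M      = overPages-⊆ (not (X′ r)) b ∘ R⊆M
        ; cost     = cost-step 0 {c} {t = t} {ρ = length R} cost (growth off r)
        }

      -- G is the cache of FbB after a possible eviction and before r is brought in.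
      Online-fault : ∀ {G E′} (refaulted : Refault r) → r ∉ F → Unique G → length G < t → G ⊆ F → E ⊆ E′ →
        (∀ {z} → z ∈ F → z ∉ G → z ∈ E′ × f z ≡ true) → (∀ {z} → z ∈ E′ → z ∈ G ⊎ z ∉ F → z ∈ E) →
        R ⊆ G → (∀ {z} → z ∈ E′ → t < length (insert r S)) →
        Online (G ++ [ r ]) E′ (update f r b) C′ (insert r S) (insert r W)
          (Refault.R′ refaulted) (M′ b) (L + fault r C) (c + 1)
      Online-fault {b = b} {G} {E′} refaulted r∉F G-unique G<t G⊆F E⊆E′ evicted E′⊆E R⊆G E′⇒S′-size = record
        { F-unique = Unique-++[] (r∉F ∘ G⊆F) G-unique
        ; F-size   = subst (_≤ t) (sym (length-++[] G)) G<t
        ; F⊆S      = λ q∈ → [ ⊆-insert ∘ F⊆S ∘ G⊆F , (λ { (here refl) → ∈-insert r S }) ]′ (∈-++⁻ G q∈)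
        ; S∖F⊆E    = S∖F⊆E′
        ; absent   = absent′
        ; returned = λ q∈E′ q∈ →
            [ (λ q∈G → returned-step s (E′⊆E q∈E′ (inj₁ q∈G)) (G⊆F q∈G)) , (λ { (here refl) → inj₁ (LFDStep-∈ s) }) ]′
              (∈-++⁻ G q∈)
        ; E⇒S-size = E′⇒S′-size
        ; R-unique = R′-unique
        ; R⊆F      = λ q∈ → [ (λ { refl → r∈G+r }) , ∈-++⁺ˡ ∘ R⊆G ]′ (R′⊆ q∈)
        ; R⊆E      = E⊆E′ ∘ R′⊆E
        ; R⊆M      = overPages-⊆ (not (X′ r)) b ∘ R′⊆M
        ; cost     = cost′
        }
        where
        open Refault refaulted

        r∈G+r : r ∈ G ++ [ r ]
        r∈G+r = ∈-++⁺ʳ G (here refl)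

        S∖F⊆E′ : ∀ {q} → q ∈ insert r S → q ∉ G ++ [ r ] → q ∈ E′
        S∖F⊆E′ {q} q∈ q∉ with q ∈? F
        ... | yes q∈F = proj₁ (evicted q∈F (q∉ ∘ ∈-++⁺ˡ))
        ... | no  q∉F = E⊆E′ (S∖F⊆E (∈-S′ q∈ λ { refl → q∉ r∈G+r }) q∉F)

        absent′ : ∀ {q} → q ∈ E′ → q ∉ G ++ [ r ] → update f r b q ≡ true
        absent′ {q} q∈E′ q∉ = trans (update-other f λ { refl → q∉ r∈G+r }) fq
          where
          fq : f q ≡ true
          fq with q ∈? F
          ... | yes q∈F = proj₂ (evicted q∈F (q∉ ∘ ∈-++⁺ˡ))
          ... | no  q∉F = absent (E′⊆E q∈E′ (inj₂ q∉F)) q∉F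

      Online-fill : (refaulted : Refault r) → r ∉ F → length F < t →
        Online (F ++ [ r ]) E (update f r b) C′ (insert r S) (insert r W)
          (Refault.R′ refaulted) (M′ b) (L + fault r C) (c + 1)
      Online-fill refaulted r∉F F<t =
        Online-fault refaulted r∉F F-unique F<t (λ q∈ → q∈) (λ q∈ → q∈)
          (λ z∈F z∉F → contradiction z∈F z∉F) (λ z∈E _ → z∈E) R⊆F
          (λ z∈E → ℕ.≤-trans (E⇒S-size z∈E) S-size-mono)

      F+r⊆S′ : F ++ [ r ] ⊆ insert r S
      F+r⊆S′ q∈ = [ ⊆-insert ∘ F⊆S , (λ { (here refl) → ∈-insert r S }) ]′ (∈-++⁻ F q∈)

      -- A full cache and the faulting page are `t + 1` distinct pages of the block.
      full-size : r ∉ F → t ≤ length F → t < length (insert r S)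
      full-size r∉F t≤F = ℕ.≤-trans (s≤s t≤F) (subst (_≤ length (insert r S)) (length-++[] F)
        (Unique-⊆⇒length≤ (Unique-++[] r∉F F-unique) F+r⊆S′))

      Online-evict : (refaulted : Refault r) → r ∉ F → t ≤ length F → q ∈ F → q ∉ E → f q ≡ true →
        Online (remove q F ++ [ r ]) (q ∷ E) (update f r b) C′ (insert r S) (insert r W)
          (Refault.R′ refaulted) (M′ b) (L + fault r C) (c + 1)
      Online-evict {q = q} refaulted r∉F t≤F q∈F q∉E fq =
        Online-fault refaulted r∉F (filter⁺ (λ y → ¬? (y Fin.≟ q)) F-unique)
          (ℕ.≤-trans (length-remove q∈F) F-size) (proj₁ ∘ ∈-remove⁻) there evicted E′⊆E
          -- Members of `R` were evicted before and FbB never evicts a page twice in a block, so `R`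
          -- stays inside the cache.
          (λ z∈R → ∈-remove⁺ (R⊆F z∈R) λ { refl → q∉E (R⊆E z∈R) })
          (λ _ → full-size r∉F t≤F)
        where
        evicted : ∀ {z} → z ∈ F → z ∉ remove q F → z ∈ q ∷ E × f z ≡ true
        evicted {z} z∈F z∉ with z Fin.≟ q
        ... | yes refl = here refl , fq
        ... | no  z≢q  = contradiction (∈-remove⁺ z∈F z≢q) z∉

        E′⊆E : ∀ {z} → z ∈ q ∷ E → z ∈ remove q F ⊎ z ∉ F → z ∈ E
        E′⊆E (there z∈E) _            = z∈E
        E′⊆E (here refl) (inj₁ q∈F∖q) = contradiction refl (proj₂ (∈-remove⁻ {C = F} q∈F∖q))
        E′⊆E (here refl) (inj₂ q∉F)   = contradiction q∈F q∉F

      -- LFD cannot hold all t + 1 pages of F and r. A page z ∈ F that it lacks was either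
      -- mispredicted to be kept, or has returned to F after an eviction, which forces L ≥ 2.
      flush-charge : r ∉ F → t ≤ length F → (∀ {z} → z ∈ F → f z ≡ true → z ∈ E) →
        (∀ {z} → z ∉ C′ → X′ z ≡ false) →
        2 ≤ L + fault r C ⊎ (1 ≤ L + fault r C × 1 ≤ m₀ + μ₀-bit (not (X′ r)) b)
      flush-charge {b = b} r∉F t≤F exhausted dropped
        with z , z∈ , z∉C′ ← escapes {C = C′} (Unique-++[] r∉F F-unique)
               (subst (length C′ <_) (sym (length-++[] F)) (s≤s (ℕ.≤-trans (LFDStep-length s cache-size) t≤F)))
        with ∈-++⁻ F z∈
      ... | inj₂ (here refl) = contradiction (LFDStep-∈ s) z∉C′
      ... | inj₁ z∈F with f z in fz
      ...   | true  = [ (λ z∈C′ → contradiction z∈C′ z∉C′) , inj₁ ]′ (returned-step s (exhausted z∈F fz) z∈F)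
      ...   | false = inj₂ (1≤L′ , Offline.under off′ (F+r⊆S′ z∈)
                        (trans (update-other f λ { refl → r∉F z∈F }) fz) (dropped z∉C′))
        where
        off′ : Offline C′ X′ (update f r b) (insert r S) (insert r W) (M′ b)
                 (L + fault r C) (m₀ + μ₀-bit (not (X′ r)) b)
        off′ = Offline-step off s X~X′
        1≤L′ : 1 ≤ L + fault r C
        1≤L′ = ℕ.+-cancelˡ-≤ t 1 _ (ℕ.≤-trans (ℕ.≤-reflexive (ℕ.+-comm t 1))
                 (ℕ.≤-trans (full-size r∉F t≤F) (Offline.S-size off′)))

  -- Summation over the blocks.

  settle : ∀ {c L ρ} → length S ≤ length W → c + length W ≤ t + L + ρ + length S → c ≤ t + L + ρ
  settle {W = W} S≤W p = ℕ.+-cancelʳ-≤ (length W) _ _ (ℕ.≤-trans p (ℕ.+-monoʳ-≤ _ S≤W))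

  -- Induction on the remaining requests from the middle of a block, with `c`, `L`, `m₀` and
  -- `length M` accumulating what the current block has contributed so far.
  block-bound : ∀ I {C Cs F E f S W R M L m₀ c} → LFDFrom t C (requests I) Cs →
    Offline C (λ q → kept q (requests I) (C ∷ Cs)) f S W M L m₀ → Online F E f C S W R M L c →
    Bound (c + fbbFrom t ⟨ F , E , f ⟩ I) (L + faults C (requests I) Cs)
      (m₀ + μ₀ I Cs) (length M + μ₁ I Cs) (2 * t)
  block-bound [] {f = f} {S} {W} {R} {M} {L} {m₀} {c} done off on
    rewrite ℕ.+-identityʳ c | ℕ.+-identityʳ L | ℕ.+-identityʳ m₀ | ℕ.+-identityʳ (length M) =
    Bound-partial {m₀ = m₀} (settle {S} {W} (Unique-⊆⇒length≤ S-unique S⊆W) cost)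
      (ℕ.≤-trans (Unique-⊆⇒length≤ R-unique R⊆F) (ℕ.≤-trans F-size (ℕ.n≤1+n t)))
      (Unique-⊆⇒length≤ R-unique R⊆M)
    where
    open Offline off
    open Online on
  block-bound ((r , b) ∷ I) {C} {C′ ∷ Cs} {F} {E} {f} {S} {W} {R} {M} {L} {m₀} {c} (step s run) off on
    with k , st , view , eq ← fbbStep t F E f r b I
    rewrite eq | μ₀′-∷ (not (kept r (requests I) (C′ ∷ Cs))) b (xbits (requests I) Cs) (predictions I)
          | μ₁′-∷ (not (kept r (requests I) (C′ ∷ Cs))) b (xbits (requests I) Cs) (predictions I) =
    Bound-regroup c k _ L (fault r C) _ m₀ (μ₀-bit x b) _ (length M) (μ₁-bit x b) _
      (subst (λ m → Bound _ _ (m₀ + μ₀-bit x b + μ₀ I Cs) (m + μ₁ I Cs) (2 * t)) (length-overPages x b) (continue view))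
    where
    keptBefore keptAfter : Page N → Bool
    keptBefore q = kept q (r ∷ requests I) (C ∷ C′ ∷ Cs)
    keptAfter q = kept q (requests I) (C′ ∷ Cs)

    x : Bool
    x = not (keptAfter r)

    kept~ : ∀ {q} → q ≢ r → keptBefore q ≡ keptAfter q
    kept~ = kept-step s

    off′ : Offline C′ keptAfter (update f r b) (insert r S) (insert r W) (overPages r x b M)
             (L + fault r C) (m₀ + μ₀-bit x b)
    off′ = Offline-step off s kept~

    refaulted : r ∉ F → Refault off on r
    refaulted = refault off on (kept-∈ {rs = requests I} {C′ ∷ Cs})

    continue : ∀ {k st} → FbBStep t F E f r b k st →
      Bound (c + k + fbbFrom t st I) (L + fault r C + faults C′ (requests I) Cs)
        (m₀ + μ₀-bit x b + μ₀ I Cs) (length (overPages r x b M) + μ₁ I Cs) (2 * t)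
    continue (hit r∈F) = block-bound I run off′ (Online-hit off on s kept~ r∈F)
    continue (fill r∉F F<t) =
      block-bound I run off′ (Online-fill off on s kept~ (refaulted r∉F) r∉F F<t)
    continue (evict q r∉F t≤F q∈F q∉E fq) =
      block-bound I run off′ (Online-evict off on s kept~ (refaulted r∉F) r∉F t≤F q∈F q∉E fq)
    -- The finished block needs no additive constant, so `2 * t` is spent once, on the unfinished
    -- last block. LFD carries its cache into the new block.
    continue (flush r∉F t≤F exhausted) = Bound-+ {m₀ = m₀ + μ₀-bit x b}
      (Bound-block (settle {insert r S} {insert r W} (Unique-⊆⇒length≤ S′-unique S′⊆W′) cost′)
        -- The closing request may itself join `R`, hence `1 + t` rather than `t`.
        (ℕ.≤-trans (Unique-⊆⇒length≤ R′-unique R′⊆r∷F) (s≤s (Online.F-size on)))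
        (Unique-⊆⇒length≤ R′-unique (overPages-⊆ x b ∘ R′⊆M))
        (flush-charge off on s kept~ r∉F t≤F exhausted (kept-∉ (requests I))))
      (block-bound I run (Offline-start cache-size′) (Online-start cache-size′))
      where
      open Refault (refaulted r∉F)
      open Offline off′ using () renaming (S-unique to S′-unique; S⊆W to S′⊆W′; cache-size to cache-size′)
      R′⊆r∷F : R′ ⊆ r ∷ F
      R′⊆r∷F q∈ = [ here , there ∘ Online.R⊆F on ]′ (R′⊆ q∈)

-- Passage to rational coefficients.

open import Data.Rational using (ℚ; 1ℚ; _+_; _-_)
import Data.Rational as ℚ

toℚᵘ-ℕ→ℚ : ∀ n → ℚ.toℚᵘ (ℕ→ℚ n) ℚᵘ.≃ mkℚᵘ (+ n) 0
toℚᵘ-ℕ→ℚ n = ℚ.toℚᵘ-fromℚᵘ (mkℚᵘ (+ n) 0)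

ℕ→ℚ-mono-≤ : ∀ {m n} → m ≤ n → ℕ→ℚ m ℚ.≤ ℕ→ℚ n
ℕ→ℚ-mono-≤ {m} {n} m≤n = ℚ.toℚᵘ-cancel-≤
  (ℚᵘ.≤-respˡ-≃ (ℚᵘ.≃-sym (toℚᵘ-ℕ→ℚ m)) (ℚᵘ.≤-respʳ-≃ (ℚᵘ.≃-sym (toℚᵘ-ℕ→ℚ n))
    (*≤* (ℤ.*-monoʳ-≤-nonNeg (+ 1) (ℤ.+≤+ m≤n)))))

ℕ→ℚ-+ : ∀ m n → ℕ→ℚ (m ℕ.+ n) ≡ ℕ→ℚ m + ℕ→ℚ n
ℕ→ℚ-+ m n = ℚ.toℚᵘ-injective (ℚᵘ.≃-trans (toℚᵘ-ℕ→ℚ (m ℕ.+ n)) (ℚᵘ.≃-trans (*≡* eq)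
  (ℚᵘ.≃-trans (ℚᵘ.+-cong (ℚᵘ.≃-sym (toℚᵘ-ℕ→ℚ m)) (ℚᵘ.≃-sym (toℚᵘ-ℕ→ℚ n)))
    (ℚᵘ.≃-sym (ℚ.toℚᵘ-homo-+ (ℕ→ℚ m) (ℕ→ℚ n))))))
  where
  eq : + (m ℕ.+ n) ℤ.* + 1 ≡ (+ m ℤ.* + 1 ℤ.+ + n ℤ.* + 1) ℤ.* + 1
  eq = cong (ℤ._* + 1) (sym (cong₂ ℤ._+_ (ℤ.*-identityʳ (+ m)) (ℤ.*-identityʳ (+ n))))

ℕ→ℚ-* : ∀ m n → ℕ→ℚ (m * n) ≡ ℕ→ℚ m ℚ.* ℕ→ℚ n
ℕ→ℚ-* m n = ℚ.toℚᵘ-injective (ℚᵘ.≃-trans (toℚᵘ-ℕ→ℚ (m * n)) (ℚᵘ.≃-trans (*≡* (cong (ℤ._* + 1) (ℤ.pos-* m n)))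
  (ℚᵘ.≃-trans (ℚᵘ.*-cong (ℚᵘ.≃-sym (toℚᵘ-ℕ→ℚ m)) (ℚᵘ.≃-sym (toℚᵘ-ℕ→ℚ n)))
    (ℚᵘ.≃-sym (ℚ.toℚᵘ-homo-* (ℕ→ℚ m) (ℕ→ℚ n))))))

3t²*oneOver3t² : ∀ k → ℕ→ℚ (3 * suc k * suc k) ℚ.* oneOver3t² (suc k) ≡ 1ℚ
3t²*oneOver3t² k = ℚ.toℚᵘ-injective (ℚᵘ.≃-trans (ℚ.toℚᵘ-homo-* (ℕ→ℚ K) (oneOver3t² (suc k)))
  (ℚᵘ.≃-trans (ℚᵘ.*-cong (toℚᵘ-ℕ→ℚ K) (ℚ.toℚᵘ-fromℚᵘ (mkℚᵘ (+ 1) (ℕ.pred K))))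
    (*≡* (trans (ℤ.*-identityʳ (+ K ℤ.* + 1)) (trans (ℤ.*-identityʳ (+ K))
      (sym (trans (ℤ.*-identityˡ (+ (1 * K))) (cong +_ (ℕ.*-identityˡ K)))))))))
  where
  K : ℕ
  K = 3 * suc k * suc k

ℕ→ℚ-cost : ∀ K c L m₁ → ℕ→ℚ (K * c ℕ.+ L ℕ.+ m₁) ≡ ℕ→ℚ K ℚ.* ℕ→ℚ c + ℕ→ℚ L + ℕ→ℚ m₁
ℕ→ℚ-cost K c L m₁ =
  trans (ℕ→ℚ-+ (K * c ℕ.+ L) m₁) (cong (_+ ℕ→ℚ m₁)
    (trans (ℕ→ℚ-+ (K * c) L) (cong (_+ ℕ→ℚ L) (ℕ→ℚ-* K c))))

ℕ→ℚ-budget : ∀ K t d L m₀ m₁ →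
  ℕ→ℚ (K * t * L ℕ.+ K * d * m₀ ℕ.+ K * m₁ ℕ.+ K * d)
    ≡ ℕ→ℚ K ℚ.* ℕ→ℚ t ℚ.* ℕ→ℚ L + ℕ→ℚ K ℚ.* ℕ→ℚ d ℚ.* ℕ→ℚ m₀ + ℕ→ℚ K ℚ.* ℕ→ℚ m₁ + ℕ→ℚ K ℚ.* ℕ→ℚ d
ℕ→ℚ-budget K t d L m₀ m₁ =
  trans (ℕ→ℚ-+ (K * t * L ℕ.+ K * d * m₀ ℕ.+ K * m₁) (K * d)) (cong₂ _+_
    (trans (ℕ→ℚ-+ (K * t * L ℕ.+ K * d * m₀) (K * m₁)) (cong₂ _+_
      (trans (ℕ→ℚ-+ (K * t * L) (K * d * m₀)) (cong₂ _+_ (product t L) (product d m₀)))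
      (ℕ→ℚ-* K m₁)))
    (ℕ→ℚ-* K d))
  where
  product : ∀ a x → ℕ→ℚ (K * a * x) ≡ ℕ→ℚ K ℚ.* ℕ→ℚ a ℚ.* ℕ→ℚ x
  product a x = trans (ℕ→ℚ-* (K * a) x) (cong (ℚ._* ℕ→ℚ x) (ℕ→ℚ-* K a))

-- Moved to the right and rewritten as `k * u * l` and `k * u * n`, the terms `l` and `n` become
-- multiples of `k`, which then cancels.
divide-by : ∀ k .{{_ : ℚ.Positive k}} u c t d l m n → k ℚ.* u ≡ 1ℚ →
  k ℚ.* c + l + n ℚ.≤ k ℚ.* t ℚ.* l + k ℚ.* d ℚ.* m + k ℚ.* n + k ℚ.* d →
  c ℚ.≤ (t - u) ℚ.* l + d ℚ.* m + (1ℚ - u) ℚ.* n + d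
divide-by k u c t d l m n ku≡1 p =
  ℚ.*-cancelˡ-≤-pos k (subst₂ ℚ._≤_ lhs rhs (ℚ.+-monoˡ-≤ (ℚ.- (l + n)) p))
  where
  open +-*-Solver
  lhs : k ℚ.* c + l + n + ℚ.- (l + n) ≡ k ℚ.* c
  lhs = solve 3 (λ a l n → a :+ l :+ n :+ (:- (l :+ n)) := a) refl (k ℚ.* c) l n

  unit : ∀ p → p ≡ k ℚ.* u ℚ.* p
  unit p = sym (trans (cong (ℚ._* p) ku≡1) (ℚ.*-identityˡ p))

  rhs : k ℚ.* t ℚ.* l + k ℚ.* d ℚ.* m + k ℚ.* n + k ℚ.* d + ℚ.- (l + n)
          ≡ k ℚ.* ((t - u) ℚ.* l + d ℚ.* m + (1ℚ - u) ℚ.* n + d)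
  rhs = trans
    (cong₂ (λ a b → k ℚ.* t ℚ.* l + k ℚ.* d ℚ.* m + k ℚ.* n + k ℚ.* d + ℚ.- (a + b)) (unit l) (unit n))
    (solve 7 (λ k t l d m n u →
        k :* t :* l :+ k :* d :* m :+ k :* n :+ k :* d :+ (:- (k :* u :* l :+ k :* u :* n))
          := k :* ((t :- u) :* l :+ d :* m :+ (con 1ℚ :- u) :* n :+ d))
      refl k t l d m n u)

rational-bound : ∀ K t d c L m₀ m₁ u .{{_ : ℕ.NonZero K}} → ℕ→ℚ K ℚ.* u ≡ 1ℚ →
  K * c ℕ.+ L ℕ.+ m₁ ≤ K * t * L ℕ.+ K * d * m₀ ℕ.+ K * m₁ ℕ.+ K * d →
  ℕ→ℚ c ℚ.≤ (ℕ→ℚ t - u) ℚ.* ℕ→ℚ L + ℕ→ℚ d ℚ.* ℕ→ℚ m₀ + (1ℚ - u) ℚ.* ℕ→ℚ m₁ + ℕ→ℚ d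
rational-bound K t d c L m₀ m₁ u Ku≡1 bound =
  divide-by (ℕ→ℚ K) {{ℚ.normalize-pos K 1}} u (ℕ→ℚ c) (ℕ→ℚ t) (ℕ→ℚ d) (ℕ→ℚ L) (ℕ→ℚ m₀) (ℕ→ℚ m₁) Ku≡1
    (subst₂ ℚ._≤_ (ℕ→ℚ-cost K c L m₁) (ℕ→ℚ-budget K t d L m₀ m₁) (ℕ→ℚ-mono-≤ bound))

theorem64 : (t N : ℕ) → 5 ≤ t → t < N →
    ∃[ κ ] ((I : Instance N) (Cs : List (Cache N)) → LFDRun t I Cs →
    ℕ→ℚ (fbbCost t I) ℚ.≤
    ((ℕ→ℚ t - oneOver3t² t) ℚ.* ℕ→ℚ (lfdCost I Cs)
    + ℕ→ℚ (2 * t) ℚ.* ℕ→ℚ (μ₀ I Cs)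
    + (1ℚ - oneOver3t² t) ℚ.* ℕ→ℚ (μ₁ I Cs)
    + κ))
theorem64 t@(suc t-1) N 5≤t _ = ℕ→ℚ (2 * t) , λ I Cs run →
  rational-bound K t (2 * t) (fbbCost t I) (lfdCost I Cs) (μ₀ I Cs) (μ₁ I Cs) (oneOver3t² t)
    (3t²*oneOver3t² t-1) (block-bound I run (Offline-start z≤n) (Online-start z≤n))
  where
  K : ℕ
  K = 3 * t * t

  open Blocks t K 5≤t (ℕ.m≤n*m t (3 * t)) N
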